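{- Let $n,m\ge 1$ be integers. The map $\Phi:\pi\mapsto D=(d_{i\ell})_{1\le i\le n,\,1\le \ell\le m}$, where $d_{i\ell}=|\{j : \pi_{i j}=\ell>\pi_{i+1\,j}\}|$, defines a bijection between the set $\mathrm{PP}(\infty,n,m)$ of plane partitions with at most $n$ rows and entries not exceeding $m$, and the set of $n\times m$ matrices ($n$ rows, $m$ columns) with nonnegative integer entries.
   Context: A plane partition $\pi=(\pi_{ij})_{i,j\ge1}$ is a two-dimensional array of nonnegative integers with finitely many nonzero entries such that $\pi_{ij}\ge\pi_{i+1\,j}$ and $\pi_{ij}\ge\pi_{i\,j+1}$ for all $i,j\ge1$. Here $i$ is the row index and $j$ the column index; zero entries are ignored, so $\pi$ has at most $n$ rows if $\pi_{ij}=0$ for all $i>n$. $\mathrm{PP}(\infty,n,m)$ is the set of plane partitions with at most $n$ (nonzero) rows and all entries at most $m$; the number of columns is not restricted. -}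

module Defs where

open import Data.Fin.Base using (Fin; toℕ)
open import Data.List.Base using (List; length; filter; map; upTo)
open import Data.List.Extrema.Nat using (max; xs≤max)
open import Data.List.Membership.Propositional using (_∈_)
open import Data.List.Membership.Propositional.Properties
  using (∈-filter⁺; ∈-filter⁻; ∈-upTo⁺; ∈-map⁺)
open import Data.List.Relation.Unary.All using (lookup)
open import Data.List.Relation.Unary.Unique.Propositional using (Unique)
import Data.List.Relation.Unary.Unique.Propositional.Properties as Unique
open import Data.Nat.Base using (ℕ; suc; _≤_; _≥_; _<_; _>_; s≤s)
open import Data.Nat.Properties using (_≟_; _>?_)
open import Data.Product.Base using (_×_; _,_; proj₁; proj₂; ∃)
open import Function.Bundles using (_⇔_; mk⇔)
open import Relation.Binary.PropositionalEquality using (_≡_; _≢_; refl)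
open import Relation.Nullary.Decidable using (Dec; _×-dec_)

-- Rows and columns are numbered from 0: `entry i j` is π_{i+1,j+1}.
record PlanePartition : Set where
  field
    entry      : ℕ → ℕ → ℕ
    -- finitely many nonzero entries: their positions all occur in a finite list
    finite     : ∃ λ (ps : List (ℕ × ℕ)) → ∀ i j → entry i j ≢ 0 → (i , j) ∈ ps
    decreasing-down  : ∀ i j → entry i j ≥ entry (suc i) j
    decreasing-right : ∀ i j → entry i j ≥ entry i (suc j)

open PlanePartition public

-- PP(∞,n,m).  With rows numbered from 0, "at most n rows" says that every row
-- of index ≥ n vanishes.
record PP (n m : ℕ) : Set where
  field
    partition  : PlanePartition
    rows≤      : ∀ i j → n ≤ i → entry partition i j ≡ 0
    entries≤   : ∀ i j → entry partition i j ≤ m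

open PP public

-- Plane partitions are equal when they are equal as arrays, regardless of the
-- proofs (in particular of the list witnessing finiteness).
_≈PP_ : ∀ {n m} → PP n m → PP n m → Set
π ≈PP ρ = ∀ i j → entry (partition π) i j ≡ entry (partition ρ) i j

Matrix : ℕ → ℕ → Set
Matrix n m = Fin n → Fin m → ℕ

_≈M_ : ∀ {n m} → Matrix n m → Matrix n m → Set
A ≈M B = ∀ i ℓ → A i ℓ ≡ B i ℓ

Descent : PlanePartition → (i ℓ j : ℕ) → Set
Descent π i ℓ j = entry π i j ≡ ℓ × ℓ > entry π (suc i) j

descent? : ∀ π i ℓ j → Dec (Descent π i ℓ j)
descent? π i ℓ j = (entry π i j ≟ ℓ) ×-dec (ℓ >? entry π (suc i) j)

-- All columns of index ≥ width π vanish.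
width : PlanePartition → ℕ
width π = suc (max 0 (map proj₂ (proj₁ (finite π))))

nonzero⇒<width : ∀ π i j → entry π i j ≢ 0 → j < width π
nonzero⇒<width π i j nz =
  s≤s (lookup (xs≤max 0 _) (∈-map⁺ proj₂ (proj₂ (finite π) i j nz)))

-- The set { j : π_{ij} = ℓ > π_{i+1,j} } as a duplicate-free list; cutting off
-- at the width loses nothing (∈-descents).
descents : PlanePartition → (i ℓ : ℕ) → List ℕ
descents π i ℓ = filter (descent? π i ℓ) (upTo (width π))

descents-unique : ∀ π i ℓ → Unique (descents π i ℓ)
descents-unique π i ℓ = Unique.filter⁺ (descent? π i ℓ) (Unique.upTo⁺ (width π))

∈-descents : ∀ π i ℓ j → j ∈ descents π i ℓ ⇔ Descent π i ℓ j
∈-descents π i ℓ j = mk⇔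
  (λ j∈ → proj₂ (∈-filter⁻ (descent? π i ℓ) {xs = upTo (width π)} j∈))
  (λ d → ∈-filter⁺ (descent? π i ℓ) (∈-upTo⁺ (nonzero⇒<width π i j (nz d))) d)
  where
  positive : ∀ {a b c} → a ≡ b × b > c → a ≢ 0
  positive (refl , ()) refl

  nz : Descent π i ℓ j → entry π i j ≢ 0
  nz = positive

-- Matrix columns are numbered from 0 but stand for the values ℓ = 1, …, m.
Φ : ∀ n m → PP n m → Matrix n m
Φ n m π i ℓ = length (descents (partition π) (toℕ i) (suc (toℕ ℓ)))

{-# OPTIONS --safe #-}
module Submission where

-- Let F i ℓ be the number of columns j with π_{ij} > ℓ.  Since π is decreasing
-- both ways, { j : π_{ij} = ℓ+1 > π_{i+1,j} } is the interval of columns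
-- from F (i+1) ℓ ⊔ F i (ℓ+1) up to F i ℓ, so D = Φ π satisfies
--   F i ℓ = D i ℓ + (F (i+1) ℓ ⊔ F i (ℓ+1)),
-- with F zero outside the n × m rectangle.  This last-passage recurrence has a
-- unique solution F for every D, and π is recovered from F by conjugating each
-- row: π_{ij} is the number of ℓ with F i ℓ > j.

open import Defs
open import Data.Fin.Base using (zero; suc; toℕ; fromℕ<)
open import Data.Fin.Properties using (toℕ-fromℕ<)
open import Data.List.Base using (length; upTo; applyUpTo; cartesianProduct)
open import Data.List.Membership.Propositional using (_∈_)
open import Data.List.Membership.Propositional.Properties using (∈-applyUpTo⁺; ∈-applyUpTo⁻; ∈-upTo⁺; ∈-cartesianProduct⁺)
open import Data.List.Membership.Propositional.Properties.WithK using (unique∧set⇒bag)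
open import Data.List.Properties using (length-applyUpTo)
open import Data.List.Relation.Binary.BagAndSetEquality using (∼bag⇒↭)
open import Data.List.Relation.Binary.Permutation.Propositional.Properties using (↭-length)
open import Data.List.Relation.Unary.Unique.Propositional using (Unique)
open import Data.List.Relation.Unary.Unique.Propositional.Properties using (applyUpTo⁺₁)
open import Data.Nat.Base using (ℕ; zero; suc; _+_; _∸_; _⊔_; _≤_; _<_; z≤n; s≤s; s≤s⁻¹; _≤′_; ≤′-refl; ≤′-step)
open import Data.Nat.Properties
open import Data.Product.Base using (_×_; _,_; proj₁; proj₂; ∃)
open import Function.Base using (_∘_)
open import Function.Bundles using (_⇔_; mk⇔; module Equivalence)
open import Function.Construct.Composition using (_⇔-∘_)
open import Function.Construct.Symmetry using (⇔-sym)
open import Function.Structures using (IsBijection)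
open import Relation.Binary.PropositionalEquality using (_≡_; refl; sym; trans; cong; cong₂; subst; module ≡-Reasoning)
open import Relation.Nullary using (yes; no; contradiction)

open Equivalence using (to; from)

-- Initial segments and intervals of natural numbers.

<-⊆⇒≤ : ∀ {a b} → (∀ k → k < a → k < b) → a ≤ b
<-⊆⇒≤ a⊆b = ≮⇒≥ λ b<a → <-irrefl refl (a⊆b _ b<a)

<-ext : ∀ {a b} → (∀ k → k < a ⇔ k < b) → a ≡ b
<-ext a⇔b = ≤-antisym (<-⊆⇒≤ (to ∘ a⇔b)) (<-⊆⇒≤ (from ∘ a⇔b))

module _ {f : ℕ → ℕ} (f-step : ∀ j → f (suc j) ≤ f j) where

  antitone : ∀ {a b} → a ≤ b → f b ≤ f a
  antitone = go ∘ ≤⇒≤′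
    where
    go : ∀ {a b} → a ≤′ b → f b ≤ f a
    go ≤′-refl       = ≤-refl
    go (≤′-step a≤b) = ≤-trans (f-step _) (go a≤b)

  -- Since `f` is antitone, the `j` with `ℓ < f j` form an initial segment. Its end is found by
  -- walking down from `w`, which is known to lie outside it. This one search conjugates rows in
  -- both directions.
  threshold : ∀ ℓ w → f w ≤ ℓ → ∃ λ b → ∀ j → j < b ⇔ ℓ < f j
  threshold ℓ zero    fw≤ℓ = 0 , λ j → mk⇔
    (λ ())
    (λ ℓ<fj → contradiction (≤-trans (antitone z≤n) fw≤ℓ) (<⇒≱ ℓ<fj))
  threshold ℓ (suc w) fw≤ℓ with ℓ <? f w
  ... | no  ℓ≮fw = threshold ℓ w (≮⇒≥ ℓ≮fw)
  ... | yes ℓ<fw = suc w , λ j → mk⇔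
    (λ j≤w → <-≤-trans ℓ<fw (antitone (s≤s⁻¹ j≤w)))
    (λ ℓ<fj → ≰⇒> λ w<j → <⇒≱ ℓ<fj (≤-trans (antitone w<j) fw≤ℓ))

-- Duplicate-free lists with the same members are permutations of each other, so `xs` is compared
-- with the enumeration of the interval by `a +_`. If `b < a` both lists are empty, in agreement
-- with truncated subtraction.
length-interval : ∀ {xs a b} → Unique xs → (∀ j → j ∈ xs ⇔ (a ≤ j × j < b)) →
                  length xs ≡ b ∸ a
length-interval {xs} {a} {b} xs! xs⇔ = trans
  (↭-length (∼bag⇒↭ (unique∧set⇒bag xs! interval! λ {j} → interval⇔ j ⇔-∘ xs⇔ j)))
  (length-applyUpTo (a +_) (b ∸ a))
  where
  interval! : Unique (applyUpTo (a +_) (b ∸ a))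
  interval! = applyUpTo⁺₁ (a +_) (b ∸ a) λ i<j _ → <⇒≢ (+-monoʳ-< a i<j)

  interval⇔ : ∀ j → (a ≤ j × j < b) ⇔ j ∈ applyUpTo (a +_) (b ∸ a)
  interval⇔ j = mk⇔
    (λ (a≤j , j<b) → subst (_∈ _) (m+[n∸m]≡n a≤j)
                       (∈-applyUpTo⁺ (a +_) (∸-monoˡ-< j<b a≤j)))
    λ j∈ → let k , k<b∸a , j≡a+k = ∈-applyUpTo⁻ (a +_) j∈ in
      subst (λ j → a ≤ j × j < b) (sym j≡a+k)
        (m≤m+n a k , ≰⇒> λ b≤a+k →
          <⇒≱ k<b∸a (subst (b ∸ a ≤_) (m+n∸m≡n a k) (∸-monoˡ-≤ a b≤a+k)))

-- The last-passage recurrence: monotonicity, uniqueness, existence.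

record LastPassage {n m} (D : Matrix n m) (F : ℕ → ℕ → ℕ) : Set where
  field
    rows≥      : ∀ i ℓ → n ≤ i → F i ℓ ≡ 0
    columns≥   : ∀ i ℓ → m ≤ ℓ → F i ℓ ≡ 0
    recurrence : ∀ i ℓ → F (toℕ i) (toℕ ℓ) ≡
                   D i ℓ + (F (suc (toℕ i)) (toℕ ℓ) ⊔ F (toℕ i) (suc (toℕ ℓ)))

  ⊔≤ : ∀ i ℓ → F (suc i) ℓ ⊔ F i (suc ℓ) ≤ F i ℓ
  ⊔≤ i ℓ with i <? n | ℓ <? m
  ... | no i≮n | _ = ≤-trans
    (≤-reflexive (cong₂ _⊔_ (rows≥ (suc i) ℓ (m≤n⇒m≤1+n (≮⇒≥ i≮n))) (rows≥ i (suc ℓ) (≮⇒≥ i≮n)))) z≤n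
  ... | yes _ | no ℓ≮m = ≤-trans
    (≤-reflexive (cong₂ _⊔_ (columns≥ (suc i) ℓ (≮⇒≥ ℓ≮m)) (columns≥ i (suc ℓ) (m≤n⇒m≤1+n (≮⇒≥ ℓ≮m))))) z≤n
  -- Matching on `toℕ-fromℕ<` replaces `i` and `ℓ` by images under `toℕ`, the only indices at which
  -- `recurrence` applies.
  ... | yes i<n | yes ℓ<m with fromℕ< i<n | toℕ-fromℕ< i<n | fromℕ< ℓ<m | toℕ-fromℕ< ℓ<m
  ... | i′ | refl | ℓ′ | refl = ≤-trans (m≤n+m _ (D i′ ℓ′)) (≤-reflexive (sym (recurrence i′ ℓ′)))

  decreasing-rows : ∀ i ℓ → F (suc i) ℓ ≤ F i ℓ
  decreasing-rows i ℓ = m⊔n≤o⇒m≤o _ _ (⊔≤ i ℓ)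

  decreasing-columns : ∀ i ℓ → F i (suc ℓ) ≤ F i ℓ
  decreasing-columns i ℓ = m⊔n≤o⇒n≤o _ _ (⊔≤ i ℓ)

  decreasing-corner : ∀ i ℓ → F i ℓ ≤ F 0 0
  decreasing-corner i ℓ = ≤-trans
    (antitone {λ i → F i ℓ} (λ i → decreasing-rows i ℓ) z≤n)
    (antitone (decreasing-columns 0) z≤n)

open LastPassage

tailRows : ∀ {n m} → Matrix (suc n) m → Matrix n m
tailRows D i ℓ = D (suc i) ℓ

tailColumns : ∀ {n m} → Matrix n (suc m) → Matrix n m
tailColumns D i ℓ = D i (suc ℓ)

tailRows-lastPassage : ∀ {n m} {D : Matrix (suc n) m} {F} →
  LastPassage D F → LastPassage (tailRows D) (λ i ℓ → F (suc i) ℓ)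
tailRows-lastPassage p = record
  { rows≥      = λ i ℓ n≤i → rows≥ p (suc i) ℓ (s≤s n≤i)
  ; columns≥   = λ i → columns≥ p (suc i)
  ; recurrence = λ i → recurrence p (suc i)
  }

tailColumns-lastPassage : ∀ {n m} {D : Matrix n (suc m)} {F} →
  LastPassage D F → LastPassage (tailColumns D) (λ i ℓ → F i (suc ℓ))
tailColumns-lastPassage p = record
  { rows≥      = λ i ℓ → rows≥ p i (suc ℓ)
  ; columns≥   = λ i ℓ m≤ℓ → columns≥ p i (suc ℓ) (s≤s m≤ℓ)
  ; recurrence = λ i ℓ → recurrence p i (suc ℓ)
  }

-- Dropping the first row or column leaves a solution for a smaller matrix. By induction only the
-- corner remains, and there the recurrence refers to two neighbours already known to agree.
lastPassage-unique : ∀ {n m} {D D′ : Matrix n m} {F F′} → D ≈M D′ →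
  LastPassage D F → LastPassage D′ F′ → ∀ i ℓ → F i ℓ ≡ F′ i ℓ
lastPassage-unique {zero} D≈D′ p p′ i ℓ =
  trans (rows≥ p i ℓ z≤n) (sym (rows≥ p′ i ℓ z≤n))
lastPassage-unique {suc n} D≈D′ p p′ (suc i) ℓ =
  lastPassage-unique (D≈D′ ∘ suc) (tailRows-lastPassage p) (tailRows-lastPassage p′) i ℓ
lastPassage-unique {suc n} {zero} D≈D′ p p′ zero ℓ =
  trans (columns≥ p 0 ℓ z≤n) (sym (columns≥ p′ 0 ℓ z≤n))
lastPassage-unique {suc n} {suc m} D≈D′ p p′ zero (suc ℓ) =
  lastPassage-unique (λ i → D≈D′ i ∘ suc) (tailColumns-lastPassage p) (tailColumns-lastPassage p′) 0 ℓ
lastPassage-unique {suc n} {suc m} {D} {D′} {F} {F′} D≈D′ p p′ zero zero = begin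
  F 0 0                               ≡⟨ recurrence p zero zero ⟩
  D zero zero + (F 1 0 ⊔ F 0 1)       ≡⟨ cong₂ _+_ (D≈D′ zero zero) (cong₂ _⊔_
    (lastPassage-unique (D≈D′ ∘ suc) (tailRows-lastPassage p) (tailRows-lastPassage p′) 0 0)
    (lastPassage-unique (λ i → D≈D′ i ∘ suc) (tailColumns-lastPassage p) (tailColumns-lastPassage p′) 0 0)) ⟩
  D′ zero zero + (F′ 1 0 ⊔ F′ 0 1)    ≡⟨ recurrence p′ zero zero ⟨
  F′ 0 0                              ∎
  where open ≡-Reasoning

-- The greatest weight in `D` of a lattice path that starts at `(i , ℓ)` and moves down or right.
passage : ∀ {n m} → Matrix n m → ℕ → ℕ → ℕ
passage {zero}          D i       ℓ       = 0
passage {suc n}         D (suc i) ℓ       = passage (tailRows D) i ℓ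
passage {suc n} {zero}  D zero    ℓ       = 0
passage {suc n} {suc m} D zero    (suc ℓ) = passage (tailColumns D) 0 ℓ
passage {suc n} {suc m} D zero    zero    =
  D zero zero + (passage (tailRows D) 0 0 ⊔ passage (tailColumns D) 0 0)

-- `passage` peels rows before columns, so below the first row this takes an induction over the
-- rows.
passage-tailColumns : ∀ {n m} (D : Matrix n (suc m)) i ℓ →
  passage (tailColumns D) i ℓ ≡ passage D i (suc ℓ)
passage-tailColumns {zero}  D i       ℓ = refl
passage-tailColumns {suc n} D zero    ℓ = refl
passage-tailColumns {suc n} D (suc i) ℓ = passage-tailColumns (tailRows D) i ℓ

passage-lastPassage : ∀ {n m} (D : Matrix n m) → LastPassage D (passage D)
passage-lastPassage D = record
  { rows≥ = zero-rows D ; columns≥ = zero-columns D ; recurrence = rec D }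
  where
  zero-rows : ∀ {n m} (D : Matrix n m) i ℓ → n ≤ i → passage D i ℓ ≡ 0
  zero-rows {zero}  D i       ℓ _         = refl
  zero-rows {suc n} D (suc i) ℓ (s≤s n≤i) = zero-rows (tailRows D) i ℓ n≤i

  zero-columns : ∀ {n m} (D : Matrix n m) i ℓ → m ≤ ℓ → passage D i ℓ ≡ 0
  zero-columns {zero}          D i       ℓ       _         = refl
  zero-columns {suc n}         D (suc i) ℓ       m≤ℓ       = zero-columns (tailRows D) i ℓ m≤ℓ
  zero-columns {suc n} {zero}  D zero    ℓ       _         = refl
  zero-columns {suc n} {suc m} D zero    (suc ℓ) (s≤s m≤ℓ) = zero-columns (tailColumns D) 0 ℓ m≤ℓ

  rec : ∀ {n m} (D : Matrix n m) i ℓ → passage D (toℕ i) (toℕ ℓ) ≡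
    D i ℓ + (passage D (suc (toℕ i)) (toℕ ℓ) ⊔ passage D (toℕ i) (suc (toℕ ℓ)))
  rec D (suc i) ℓ       = rec (tailRows D) i ℓ
  rec D zero    zero    = refl
  rec D zero    (suc ℓ) = trans (rec (tailColumns D) zero ℓ)
    (cong (λ x → D zero (suc ℓ) + (x ⊔ passage D 0 (suc (suc (toℕ ℓ)))))
      (passage-tailColumns D 1 (toℕ ℓ)))

-- Conjugating rows: plane partitions and solutions of the recurrence.

Conjugate : (ℕ → ℕ → ℕ) → PlanePartition → Set
Conjugate F π = ∀ i ℓ j → j < F i ℓ ⇔ ℓ < entry π i j

conjugate : ∀ π → ∃ λ F → Conjugate F π
conjugate π = (λ i ℓ → proj₁ (level i ℓ)) , λ i ℓ → proj₂ (level i ℓ)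
  where
  level : ∀ i ℓ → ∃ λ b → ∀ j → j < b ⇔ ℓ < entry π i j
  level i ℓ = threshold (decreasing-right π i) ℓ (width π)
    -- The search may start at column `width π`, where every entry is zero.
    (≮⇒≥ λ ℓ<π → <-irrefl refl (nonzero⇒<width π i (width π) (m<n⇒n≢0 ℓ<π)))

Φ-lastPassage : ∀ {n m} (π : PP n m) {F} → Conjugate F (partition π) →
  LastPassage (Φ n m π) F
Φ-lastPassage {n} {m} π {F} conj = record
  { rows≥      = λ i ℓ n≤i → vanish i ℓ λ j → ≤-trans (≤-reflexive (rows≤ π i j n≤i)) z≤n
  ; columns≥   = λ i ℓ m≤ℓ → vanish i ℓ λ j → ≤-trans (entries≤ π i j) m≤ℓ
  ; recurrence = λ i ℓ → trans (sym (m∸n+n≡m (⊔≤F (toℕ i) (toℕ ℓ))))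
                           (cong (_+ _) (sym (count (toℕ i) (toℕ ℓ))))
  }
  where
  ρ : PlanePartition
  ρ = partition π

  vanish : ∀ i ℓ → (∀ j → entry ρ i j ≤ ℓ) → F i ℓ ≡ 0
  vanish i ℓ ρ≤ℓ = n≤0⇒n≡0 (<-⊆⇒≤ λ j j<F → contradiction (ρ≤ℓ j) (<⇒≱ (to (conj i ℓ j) j<F)))

  ⊔≤F : ∀ i ℓ → F (suc i) ℓ ⊔ F i (suc ℓ) ≤ F i ℓ
  ⊔≤F i ℓ = ⊔-lub
    (<-⊆⇒≤ λ j j<F → from (conj i ℓ j) (<-≤-trans (to (conj (suc i) ℓ j) j<F) (decreasing-down ρ i j)))
    (<-⊆⇒≤ λ j j<F → from (conj i ℓ j) (<-trans (n<1+n ℓ) (to (conj i (suc ℓ) j) j<F)))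

  -- Read through `conj`, the bound `F i (suc ℓ) ≤ j` says that the entry is at most `suc ℓ`,
  -- `j < F i ℓ` that it is at least `suc ℓ`, and `F (suc i) ℓ ≤ j` that the entry below is at most
  -- `ℓ`.
  descent⇔ : ∀ i ℓ j → Descent ρ i (suc ℓ) j ⇔ (F (suc i) ℓ ⊔ F i (suc ℓ) ≤ j × j < F i ℓ)
  descent⇔ i ℓ j = mk⇔
    (λ (ρ≡1+ℓ , ρ↓≤ℓ) →
      ⊔-lub (≮⇒≥ λ j<F → <⇒≱ (to (conj (suc i) ℓ j) j<F) (s≤s⁻¹ ρ↓≤ℓ))
            (≮⇒≥ λ j<F → <-irrefl (sym ρ≡1+ℓ) (to (conj i (suc ℓ) j) j<F))
      , from (conj i ℓ j) (≤-reflexive (sym ρ≡1+ℓ)))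
    (λ (⊔≤j , j<F) →
      ≤-antisym (≮⇒≥ λ 1+ℓ<ρ → <⇒≱ (from (conj i (suc ℓ) j) 1+ℓ<ρ) (m⊔n≤o⇒n≤o _ _ ⊔≤j))
                (to (conj i ℓ j) j<F)
      , s≤s (≮⇒≥ λ ℓ<ρ↓ → <⇒≱ (from (conj (suc i) ℓ j) ℓ<ρ↓) (m⊔n≤o⇒m≤o _ _ ⊔≤j)))

  count : ∀ i ℓ → length (descents ρ i (suc ℓ)) ≡ F i ℓ ∸ (F (suc i) ℓ ⊔ F i (suc ℓ))
  count i ℓ = length-interval (descents-unique ρ i (suc ℓ))
    λ j → descent⇔ i ℓ j ⇔-∘ ∈-descents ρ i (suc ℓ) j

fromLastPassage : ∀ {n m} {D : Matrix n m} {F} → LastPassage D F →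
  ∃ λ (π : PP n m) → Conjugate F (partition π)
fromLastPassage {n} {m} {D} {F} p = record
  { partition = record
    { entry            = λ i j → proj₁ (level i j)
    -- A nonzero entry in column `j` exceeds 0, so `j < F i 0`, and `F i 0` is at most `F 0 0`.
    ; finite           = cartesianProduct (upTo n) (upTo (F 0 0)) , λ i j π≢0 →
        ∈-cartesianProduct⁺
          (∈-upTo⁺ (≰⇒> λ n≤i → π≢0 (zero-row i j n≤i)))
          (∈-upTo⁺ (<-≤-trans (to (proj₂ (level i j) 0) (n≢0⇒n>0 π≢0)) (decreasing-corner p i 0)))
    ; decreasing-down  = λ i j → <-⊆⇒≤ λ ℓ ℓ<π →
        from (proj₂ (level i j) ℓ)
          (<-≤-trans (to (proj₂ (level (suc i) j) ℓ) ℓ<π) (decreasing-rows p i ℓ))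
    ; decreasing-right = λ i j → <-⊆⇒≤ λ ℓ ℓ<π →
        from (proj₂ (level i j) ℓ) (<-trans (n<1+n j) (to (proj₂ (level i (suc j)) ℓ) ℓ<π))
    }
  ; rows≤    = zero-row
  ; entries≤ = λ i j → ≮⇒≥ λ m<π →
      n≮0 (subst (j <_) (columns≥ p i m ≤-refl) (to (proj₂ (level i j) m) m<π))
  } , λ i ℓ j → ⇔-sym (proj₂ (level i j) ℓ)
  where
  level : ∀ i j → ∃ λ b → ∀ ℓ → ℓ < b ⇔ j < F i ℓ
  level i j = threshold (decreasing-columns p i) j m
    (≤-trans (≤-reflexive (columns≥ p i m ≤-refl)) z≤n)

  zero-row : ∀ i j → n ≤ i → proj₁ (level i j) ≡ 0
  zero-row i j n≤i = n≤0⇒n≡0 (<-⊆⇒≤ λ ℓ ℓ<π →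
    contradiction (subst (j <_) (rows≥ p i ℓ n≤i) (to (proj₂ (level i j) ℓ) ℓ<π)) n≮0)

-- Bijectivity.

conjugate-cong : ∀ {π ρ F} → (∀ i j → entry π i j ≡ entry ρ i j) →
  Conjugate F π → Conjugate F ρ
conjugate-cong π≈ρ conj i ℓ j = subst (λ e → _ ⇔ ℓ < e) (π≈ρ i j) (conj i ℓ j)

-- The recurrence gives `D` back from `F` by cancellation, the converse of `lastPassage-unique`.
lastPassage-injective : ∀ {n m} {D D′ : Matrix n m} {F} →
  LastPassage D F → LastPassage D′ F → D ≈M D′
lastPassage-injective p p′ i ℓ =
  +-cancelʳ-≡ _ _ _ (trans (sym (recurrence p i ℓ)) (recurrence p′ i ℓ))

-- Equal arrays may carry different finiteness lists, hence different widths, and `Φ` filters up to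
-- the width. Both images nevertheless solve the recurrence for one common `F`.
Φ-cong : ∀ {n m} {π ρ : PP n m} → π ≈PP ρ → Φ n m π ≈M Φ n m ρ
Φ-cong {π = π} {ρ} π≈ρ = lastPassage-injective (Φ-lastPassage π conj)
  (Φ-lastPassage ρ (conjugate-cong {partition π} {partition ρ} π≈ρ conj))
  where conj = proj₂ (conjugate (partition π))

Φ-injective : ∀ {n m} {π ρ : PP n m} → Φ n m π ≈M Φ n m ρ → π ≈PP ρ
Φ-injective {π = π} {ρ} Φπ≈Φρ i j = <-ext λ ℓ →
  conjρ i ℓ j ⇔-∘ subst (λ b → _ ⇔ j < b) (F≡F′ i ℓ) (⇔-sym (conjπ i ℓ j))
  where
  conjπ = proj₂ (conjugate (partition π))
  conjρ = proj₂ (conjugate (partition ρ))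
  F≡F′  = lastPassage-unique Φπ≈Φρ (Φ-lastPassage π conjπ) (Φ-lastPassage ρ conjρ)

Φ-surjective : ∀ {n m} (D : Matrix n m) → ∃ λ π → Φ n m π ≈M D
Φ-surjective D = let π , conj = fromLastPassage (passage-lastPassage D) in
  π , lastPassage-injective (Φ-lastPassage π conj) (passage-lastPassage D)

theorem3p2 : (n m : ℕ) → 1 ≤ n → 1 ≤ m → IsBijection (_≈PP_ {n} {m}) (_≈M_ {n} {m}) (Φ n m)
theorem3p2 n m _ _ = record
  { isInjection = record
    { isCongruent = record
      { cong           = λ {π} {ρ} → Φ-cong {π = π} {ρ}
      ; isEquivalence₁ = record
        { refl  = λ _ _ → refl
        ; sym   = λ π≈ρ i j → sym (π≈ρ i j)
        ; trans = λ π≈ρ ρ≈σ i j → trans (π≈ρ i j) (ρ≈σ i j)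
        }
      ; isEquivalence₂ = record
        { refl  = λ _ _ → refl
        ; sym   = λ A≈B i ℓ → sym (A≈B i ℓ)
        ; trans = λ A≈B B≈C i ℓ → trans (A≈B i ℓ) (B≈C i ℓ)
        }
      }
    ; injective = λ {π} {ρ} → Φ-injective {π = π} {ρ}
    }
  ; surjective = λ D → let π , Φπ≈D = Φ-surjective D in
      -- Surjectivity between setoids concerns every `ρ` equal to `π` as an array, hence the use of
      -- `Φ-cong`.
      π , λ {ρ} ρ≈π i ℓ → trans (Φ-cong {π = ρ} {π} ρ≈π i ℓ) (Φπ≈D i ℓ)
  }
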